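{- Let $q$ be a prime power, let $n,k$ be positive integers with $n\geq 2k$, and let $S$ be a subset of $\{0,1,\dots,k-1\}$ with $\emptyset\neq S\neq\{0,1,\dots,k-1\}$. Put $s:=\min(S)$. Then the generalized Grassmann graph $J_{q,S}(n,k)$ has diameter \[\operatorname{diam}\left(J_{q,S}(n,k)\right)=\begin{cases}2&\text{if }s=0,\\ \left\lceil\frac{k}{k-s}\right\rceil&\text{if }s\neq0.\end{cases}\]
   Context: For a prime power $q$, $\mathbb{F}_q$ denotes the finite field of order $q$, and a $k$-subspace means a $k$-dimensional subspace of $\mathbb{F}_q^n$. For $S\subseteq\{0,1,\dots,k-1\}$, the generalized Grassmann graph $J_{q,S}(n,k)$ is the simple graph whose vertices are the $k$-subspaces of $\mathbb{F}_q^n$, two distinct vertices being adjacent if and only if the dimension of their intersection lies in $S$. The diameter is the largest distance (length of a shortest walk) between two vertices. -}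

module Defs where

open import Level using (0ℓ)
open import Algebra.Bundles using (CommutativeRing)
open import Data.Nat using (ℕ; zero; suc; _∸_; _^_; _≤_; _<_)
import Data.Nat as ℕ
open import Data.Nat.DivMod using (_/_)
open import Data.Nat.Primality using (Prime)
open import Data.Fin using (Fin; toℕ)
import Data.Fin as F
open import Data.Fin.Subset using (Subset; _∈_)
open import Data.Product using (Σ; ∃; _×_; _,_; proj₁)
open import Relation.Nullary using (¬_)
open import Relation.Binary.PropositionalEquality using (_≡_)

IsPrimePower : ℕ → Set
IsPrimePower q = ∃ λ p → ∃ λ m → Prime p × 1 ≤ m × q ≡ p ^ m

record IsFiniteField (q : ℕ) (R : CommutativeRing 0ℓ 0ℓ) : Set where
  open CommutativeRing R
  field
    0≉1       : ¬ (0# ≈ 1#)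
    inverse   : ∀ x → ¬ (x ≈ 0#) → ∃ λ y → x * y ≈ 1#
    enum      : Fin q → Carrier
    enum-surj : ∀ x → ∃ λ i → enum i ≈ x
    enum-inj  : ∀ i j → enum i ≈ enum j → i ≡ j

module Grassmann (R : CommutativeRing 0ℓ 0ℓ) (n : ℕ) where
  open CommutativeRing R

  Vector : Set
  Vector = Fin n → Carrier

  _≋_ : Vector → Vector → Set
  u ≋ v = ∀ i → u i ≈ v i

  zeroV : Vector
  zeroV _ = 0#

  _+V_ : Vector → Vector → Vector
  (u +V v) i = u i + v i

  _·V_ : Carrier → Vector → Vector
  (c ·V v) i = c * v i

  sumF : ∀ {d} → (Fin d → Carrier) → Carrier
  sumF {zero}  f = 0#
  sumF {suc d} f = f F.zero + sumF (λ j → f (F.suc j))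

  lincomb : ∀ {d} → (Fin d → Carrier) → (Fin d → Vector) → Vector
  lincomb c b i = sumF (λ j → c j * b j i)

  record Subspace : Set₁ where
    field
      member   : Vector → Set
      resp     : ∀ {u v} → u ≋ v → member u → member v
      zero∈    : member zeroV
      +-closed : ∀ {u v} → member u → member v → member (u +V v)
      ·-closed : ∀ c {v} → member v → member (c ·V v)
  open Subspace public

  _∩_ : Subspace → Subspace → Subspace
  U ∩ W = record
    { member   = λ v → member U v × member W v
    ; resp     = λ e (a , b) → resp U e a , resp W e b
    ; zero∈    = zero∈ U , zero∈ W
    ; +-closed = λ (a , b) (a' , b') → +-closed U a a' , +-closed W b b'
    ; ·-closed = λ c (a , b) → ·-closed U c a , ·-closed W c b
    }

  _≐_ : Subspace → Subspace → Set
  U ≐ W = ∀ v → (member U v → member W v) × (member W v → member U v)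

  LinIndep : ∀ {d} → (Fin d → Vector) → Set
  LinIndep b = ∀ c → lincomb c b ≋ zeroV → ∀ j → c j ≈ 0#

  IsBasis : ∀ {d} → Subspace → (Fin d → Vector) → Set
  IsBasis W b = (∀ j → member W (b j)) × LinIndep b
              × (∀ v → member W v → ∃ λ c → lincomb c b ≋ v)

  HasDim : Subspace → ℕ → Set
  HasDim W d = ∃ λ (b : Fin d → Vector) → IsBasis W b

  Vertex : ℕ → Set₁
  Vertex k = Σ Subspace (λ W → HasDim W k)

  Adjacent : ∀ {k} → Subset k → Vertex k → Vertex k → Set
  Adjacent {k} S U W = ¬ (proj₁ U ≐ proj₁ W)
                     × ∃ λ (i : Fin k) → i ∈ S × HasDim (proj₁ U ∩ proj₁ W) (toℕ i)

  data Walk {k} (S : Subset k) : Vertex k → Vertex k → ℕ → Set₁ where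
    here : ∀ {U W} → proj₁ U ≐ proj₁ W → Walk S U W 0
    step : ∀ {U X W m} → Adjacent S U X → Walk S X W m → Walk S U W (suc m)

  Distance : ∀ {k} → Subset k → Vertex k → Vertex k → ℕ → Set₁
  Distance S U W d = Walk S U W d × (∀ m → Walk S U W m → d ≤ m)

  -- the graph J_{q,S}(n,k) has diameter d: every distance is at most d
  -- (in particular the graph is connected) and some distance equals d
  HasDiameter : ∀ k → Subset k → ℕ → Set₁
  HasDiameter k S d =
      (∀ (U W : Vertex k) → ∃ λ m → m ≤ d × Walk S U W m)
    × (∃ λ (U : Vertex k) → ∃ λ (W : Vertex k) → Distance S U W d)

-- ceiling division ⌈a / b⌉ (b > 0; value 0 for b = 0, never used)
ceilDiv : ℕ → ℕ → ℕ
ceilDiv a zero    = 0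
ceilDiv a (suc b) = (a ℕ.+ b) / suc b

diamValue : ℕ → ℕ → ℕ
diamValue k zero    = 2
diamValue k (suc s) = ceilDiv k (k ∸ suc s)

{-# OPTIONS --safe #-}

-- Put e = k − s. For k-subspaces U and W choose a basis zs of U ∩ W and complete it by
-- u₁ … uⱼ to a basis of U and by w₁ … wⱼ to one of W; then zs, u, w are jointly independent.
-- Exchanging e of the uᵢ for the corresponding wᵢ is one step along s ∈ S and lowers j by e.
-- As soon as j ≤ 2e, some X meets both U and W in dimension exactly s: it is spanned by
-- part of zs, some of the uᵢ, the same number of the wᵢ, some sums uᵢ + wᵢ, and (if j < e)
-- vectors outside U + W, for which n ≥ 2k leaves room. Hence the diameter is at most
-- max(2, ⌈k/e⌉). Conversely a walk of length m puts U into W + ⟨m·e vectors⟩, so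
-- U ∩ W = 0 forces distance at least ⌈k/e⌉; if s = 0, a pair meeting in a dimension outside S
-- is at distance at least 2.
module Submission where

open import Defs
open import Level using (0ℓ)
open import Algebra.Bundles using (CommutativeRing)
import Algebra.Properties.Ring as RingProperties
import Algebra.Solver.CommutativeMonoid as CommutativeMonoidSolver
import Algebra.Solver.Ring.NaturalCoefficients.Default as SemiringSolver
open import Data.Nat using (ℕ; zero; suc; _*_; _≤_; z≤n; s≤s)
import Data.Nat as ℕ
open import Data.Nat.DivMod using (_/_; _%_; m%n<n; m≡m%n+[m/n]*n; m<n*o⇒m/o<n)
import Data.Nat.Properties as ℕ
open import Data.Nat.Solver using (module +-*-Solver)
open import Data.Fin using (Fin; toℕ)
import Data.Fin as F
import Data.Fin.Properties as F
open import Data.Fin.Subset using (Subset; _∈_; Nonempty; ⊤)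
open import Data.Fin.Subset.Properties using (_∈?_; ∈⊤; ⊆-antisym)
open import Data.List using (List; []; _∷_; _++_; length; lookup; tabulate; map)
open import Data.List.Membership.Propositional.Properties using (∈-lookup)
open import Data.List.Properties using (length-++; length-map; length-tabulate; map-++; ++-assoc)
open import Data.List.Relation.Unary.All as All using (All; []; _∷_)
open import Data.List.Relation.Unary.All.Properties using (++⁺; ++⁻ˡ; ++⁻ʳ; tabulate⁺)
open import Data.List.Relation.Binary.Permutation.Propositional using (_↭_; ↭-sym; ↭-refl)
open import Data.List.Relation.Binary.Permutation.Propositional.Properties using (All-resp-↭; ↭-length; ++-comm; shift; ++-commutativeMonoid)
open import Data.Product using (∃; ∃₂; _×_; _,_; proj₁; proj₂)
open import Data.Sum using (inj₁; inj₂)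
open import Data.Unit using (tt) renaming (⊤ to Unit)
open import Function using (_∘_)
open import Relation.Nullary using (¬_; Dec; yes; no; contradiction)
import Relation.Nullary.Decidable as Dec
open import Relation.Binary.PropositionalEquality as ≡ using (_≡_)

-- Linear algebra over a finite field: scalars and cancellation.

module LinearAlgebra (R : CommutativeRing 0ℓ 0ℓ) {q : ℕ} (isField : IsFiniteField q R) (n : ℕ) where
  open CommutativeRing R hiding (zero) renaming (_*_ to _⋆_)
  open IsFiniteField isField
  open Grassmann R n
  open RingProperties ring using (-1*x≈-x)
  open SemiringSolver commutativeSemiring using (solve; _:+_; _:*_; _:=_)

  -- The enumeration is injective up to `≈`, so comparing indices decides equality. Every split on
  -- whether a coefficient vanishes rests on this.
  _≈?_ : ∀ x y → Dec (x ≈ y)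
  x ≈? y with enum-surj x | enum-surj y
  ... | i , ei | j , ej = Dec.map′
    (λ { ≡.refl → trans (sym ei) ej })
    (λ x≈y → enum-inj i j (trans ei (trans x≈y (sym ej))))
    (i F.≟ j)

  ≋-refl : ∀ u → u ≋ u
  ≋-refl u i = refl

  ≋-sym : ∀ {u v} → u ≋ v → v ≋ u
  ≋-sym e i = sym (e i)

  ≋-trans : ∀ {u v w} → u ≋ v → v ≋ w → u ≋ w
  ≋-trans e f i = trans (e i) (f i)

  infix 4 _⊑_

  _⊑_ : List Vector → Subspace → Set
  vs ⊑ T = All (member T) vs

  +-cancelʳ : ∀ x y → (x + y) + - 1# ⋆ y ≈ x
  +-cancelʳ x y = trans (+-congˡ (-1*x≈-x y))
    (trans (+-assoc x y (- y)) (trans (+-congˡ (-‿inverseʳ y)) (+-identityʳ x)))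

  member-cancelʳ : ∀ T {v x y} → v ≋ (x +V y) → member T v → member T y → member T x
  member-cancelʳ T {v} {x} {y} e v∈ y∈ = resp T
    (λ i → trans (+-congʳ (e i)) (+-cancelʳ (x i) (y i)))
    (+-closed T v∈ (·-closed T (- 1#) y∈))

  member-cancelˡ : ∀ T {v x y} → v ≋ (x +V y) → member T v → member T x → member T y
  member-cancelˡ T {v} {x} {y} e = member-cancelʳ T (λ i → trans (e i) (+-comm (x i) (y i)))

  member-unscale : ∀ T {c b} → ¬ (c ≈ 0#) → member T (c ·V b) → member T b
  member-unscale T {c} {b} c≉0 cb∈ with inverse c c≉0
  ... | d , cd≈1 = resp T
    (λ i → trans (sym (*-assoc d c (b i)))
      (trans (*-congʳ (trans (*-comm d c) cd≈1)) (*-identityˡ (b i))))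
    (·-closed T d cb∈)

  member-solve : ∀ T {v r c b} → v ≋ ((c ·V b) +V r) → ¬ (c ≈ 0#)
               → member T v → member T r → member T b
  member-solve T e c≉0 v∈ r∈ = member-unscale T c≉0 (member-cancelʳ T e v∈ r∈)

  zero-coefficient : ∀ {v r c b} → v ≋ ((c ·V b) +V r) → c ≈ 0# → v ≋ r
  zero-coefficient {v} {r} {c} {b} e c≈0 i = trans (e i)
    (trans (+-congʳ (trans (*-congʳ c≈0) (zeroˡ (b i)))) (+-identityˡ (r i)))

  -- Spans of lists of vectors.

  -- The vector is tied to its combination only by an `≋` equation, so pattern matching exposes the
  -- head coefficient together with a remainder in the span of the tail.
  data Span : List Vector → Vector → Set where
    nil  : ∀ {v} → v ≋ zeroV → Span [] v
    cons : ∀ {b bs v} c {r} → v ≋ ((c ·V b) +V r) → Span bs r → Span (b ∷ bs) v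

  Span-resp : ∀ {bs u v} → u ≋ v → Span bs u → Span bs v
  Span-resp e (nil z)       = nil (≋-trans (≋-sym e) z)
  Span-resp e (cons c f sp) = cons c (≋-trans (≋-sym e) f) sp

  Span-zero : ∀ bs → Span bs zeroV
  Span-zero []       = nil (λ _ → refl)
  Span-zero (b ∷ bs) = cons 0# (λ i → sym (trans (+-identityʳ _) (zeroˡ (b i)))) (Span-zero bs)

  Span-+ : ∀ {bs u v} → Span bs u → Span bs v → Span bs (u +V v)
  Span-+ (nil z) (nil z′) = nil (λ i → trans (+-cong (z i) (z′ i)) (+-identityˡ 0#))
  Span-+ (cons {b} c {r} e sp) (cons c′ {r′} e′ sp′) = cons (c + c′)
    (λ i → trans (+-cong (e i) (e′ i))
      (solve 5 (λ c c′ b r r′ → (c :* b :+ r) :+ (c′ :* b :+ r′) := (c :+ c′) :* b :+ (r :+ r′))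
        refl c c′ (b i) (r i) (r′ i)))
    (Span-+ sp sp′)

  Span-· : ∀ {bs} d {v} → Span bs v → Span bs (d ·V v)
  Span-· d (nil z) = nil (λ i → trans (*-congˡ (z i)) (zeroʳ d))
  Span-· d (cons {b} c {r} e sp) = cons (d ⋆ c)
    (λ i → trans (*-congˡ (e i))
      (solve 4 (λ d c b r → d :* (c :* b :+ r) := (d :* c) :* b :+ d :* r) refl d c (b i) (r i)))
    (Span-· d sp)

  ⟨_⟩ : List Vector → Subspace
  ⟨ bs ⟩ = record
    { member   = Span bs
    ; resp     = Span-resp
    ; zero∈    = Span-zero bs
    ; +-closed = Span-+
    ; ·-closed = Span-·
    }

  Span-least : ∀ T {bs v} → bs ⊑ T → Span bs v → member T v
  Span-least T []         (nil z)       = resp T (≋-sym z) (zero∈ T)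
  Span-least T (b∈ ∷ bs⊑) (cons c e sp) = resp T (≋-sym e)
    (+-closed T (·-closed T c b∈) (Span-least T bs⊑ sp))

  Span-head : ∀ {b bs} → Span (b ∷ bs) b
  Span-head {b} {bs} = cons 1#
    (λ i → sym (trans (+-identityʳ _) (*-identityˡ (b i)))) (Span-zero bs)

  Span-tail : ∀ {b bs v} → Span bs v → Span (b ∷ bs) v
  Span-tail {b} {v = v} sp = cons 0#
    (λ i → sym (trans (+-congʳ (zeroˡ (b i))) (+-identityˡ (v i)))) sp

  Span-self : ∀ bs → bs ⊑ ⟨ bs ⟩
  Span-self []       = []
  Span-self (b ∷ bs) = Span-head ∷ All.map Span-tail (Span-self bs)

  Span-↭ : ∀ {bs cs} → bs ↭ cs → bs ⊑ ⟨ cs ⟩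
  Span-↭ {bs} {cs} p = All-resp-↭ (↭-sym p) (Span-self cs)

  left⊑ : ∀ as {bs} → as ⊑ ⟨ as ++ bs ⟩
  left⊑ as {bs} = ++⁻ˡ as (Span-self (as ++ bs))

  right⊑ : ∀ as {bs} → bs ⊑ ⟨ as ++ bs ⟩
  right⊑ as {bs} = ++⁻ʳ as (Span-self (as ++ bs))

  Span-split : ∀ as {bs v} → Span (as ++ bs) v
             → ∃₂ λ x y → Span as x × Span bs y × v ≋ (x +V y)
  Span-split []       {v = v} sp = zeroV , v , nil (λ _ → refl) , sp , λ i → sym (+-identityˡ (v i))
  Span-split (a ∷ as) (cons c e sp) with Span-split as sp
  ... | x , y , x∈ , y∈ , f = (c ·V a) +V x , y , cons c (λ _ → refl) x∈ , y∈ ,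
    λ i → trans (e i) (trans (+-congˡ (f i)) (sym (+-assoc (c ⋆ a i) (x i) (y i))))

  -- Only finitely many head coefficients need trying: subtract each multiple of `b` and decide
  -- membership in the span of the tail.
  Span? : ∀ bs v → Dec (Span bs v)
  Span? []       v = Dec.map′ nil (λ { (nil z) → z }) (F.all? λ i → v i ≈? 0#)
  Span? (b ∷ bs) v = Dec.map′ to from (F.any? λ i → Span? bs (v +V ((- 1#) ·V (enum i ·V b))))
    where
    to : (∃ λ i → Span bs (v +V ((- 1#) ·V (enum i ·V b)))) → Span (b ∷ bs) v
    to (i , sp) = member-cancelʳ ⟨ b ∷ bs ⟩ (λ _ → refl) (Span-tail sp)
      (Span-· (- 1#) (Span-· (enum i) Span-head))
    from : Span (b ∷ bs) v → ∃ λ i → Span bs (v +V ((- 1#) ·V (enum i ·V b)))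
    from (cons c {r} e sp) with enum-surj c
    ... | i , ei = i , Span-resp
      (λ j → sym (trans (+-congʳ (trans (e j) (trans (+-congʳ (*-congʳ (sym ei))) (+-comm _ _))))
        (+-cancelʳ (r j) (enum i ⋆ b j)))) sp

  -- Independence, exchange and counting.

  -- The recursive form suits induction on lists; that the order does not matter is recovered in
  -- `Indep-↭` by a dimension count.
  Indep : List Vector → Set
  Indep []       = Unit
  Indep (b ∷ bs) = ¬ Span bs b × Indep bs

  Indep-++ʳ : ∀ as {bs} → Indep (as ++ bs) → Indep bs
  Indep-++ʳ []       ind       = ind
  Indep-++ʳ (a ∷ as) (_ , ind) = Indep-++ʳ as ind

  -- As `a` lies outside the span of `as`, some entry of `cs` occurs with nonzero coefficient; the
  -- first such entry is expressed through `a` and the others, and dropped. `P` carries along what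
  -- is known about the entries kept.
  exchange : ∀ {P : Vector → Set} cs {as a} → All P cs → Span (cs ++ as) a → ¬ Span as a
           → ∃ λ cs′ → suc (length cs′) ≡ length cs × All P cs′ × cs ⊑ ⟨ cs′ ++ a ∷ as ⟩
  exchange []                []         a∈            a∉ = contradiction a∈ a∉
  exchange (c ∷ cs) {as} {a} (pc ∷ pcs) (cons γ e sp) a∉ with γ ≈? 0#
  ... | yes γ≈0 =
    let cs′ , len , pcs′ , cs⊑ = exchange cs pcs (Span-resp (≋-sym (zero-coefficient e γ≈0)) sp) a∉
    in  c ∷ cs′ , ≡.cong suc len , pc ∷ pcs′ , Span-head ∷ All.map Span-tail cs⊑
  ... | no γ≉0 = cs , ≡.refl , pcs , member-solve T e γ≉0 a∈ r∈ ∷ left⊑ cs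
    where
    T = ⟨ cs ++ a ∷ as ⟩
    a∈ = All.head (right⊑ cs)
    r∈ = Span-least T (++⁺ (left⊑ cs) (All.tail (right⊑ cs))) sp

  -- The vectors of `as` enter from last to first, each displacing one of the remaining old
  -- generators, so the total count stays fixed.
  steinitz : ∀ {as bs} → Indep as → as ⊑ ⟨ bs ⟩
           → ∃ λ cs → length cs ℕ.+ length as ≡ length bs × cs ⊑ ⟨ bs ⟩ × bs ⊑ ⟨ cs ++ as ⟩
  steinitz {[]}     {bs} _ _ = bs , ℕ.+-identityʳ _ , Span-self bs , left⊑ bs
  steinitz {a ∷ as} {bs} (a∉ , ind) (a∈ ∷ as⊑) with steinitz ind as⊑
  ... | cs , len , cs⊑ , bs⊑ with exchange cs cs⊑ (Span-least ⟨ cs ++ as ⟩ bs⊑ a∈) a∉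
  ...   | cs′ , len′ , cs′⊑ , cs⊑′ = cs′ ,
    ≡.trans (ℕ.+-suc _ _) (≡.trans (≡.cong (ℕ._+ length as) len′) len) , cs′⊑ ,
    All.map (Span-least ⟨ cs′ ++ a ∷ as ⟩ (++⁺ cs⊑′ (All.tail (right⊑ cs′)))) bs⊑

  Indep⇒length≤ : ∀ {as bs} → Indep as → as ⊑ ⟨ bs ⟩ → length as ≤ length bs
  Indep⇒length≤ ind as⊑ with steinitz ind as⊑
  ... | cs , len , _ = ≡.subst (_ ≤_) len (ℕ.m≤n+m _ (length cs))

  -- Dropping a redundant vector from bs would leave a generating list
  -- shorter than the independent list as.
  generating⇒Indep : ∀ {as bs} → Indep as → as ⊑ ⟨ bs ⟩ → length bs ≤ length as → Indep bs
  generating⇒Indep {as} ind as⊑ len = go [] _ as⊑ len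
    where
    -- `ds` holds the entries already tested; moving `b` there only permutes the list, so span and
    -- length persist.
    go : ∀ ds bs → as ⊑ ⟨ ds ++ bs ⟩ → length (ds ++ bs) ≤ length as → Indep bs
    go ds []       as⊑ len = tt
    go ds (b ∷ bs) as⊑ len =
      (λ b∈ → ℕ.<-irrefl ≡.refl (ℕ.≤-trans
        (ℕ.≤-trans (ℕ.≤-reflexive (≡.sym (↭-length (shift b ds bs)))) len)
        (Indep⇒length≤ ind (All.map (Span-least ⟨ ds ++ bs ⟩
            (++⁺ (left⊑ ds) (Span-least ⟨ ds ++ bs ⟩ (right⊑ ds) b∈ ∷ right⊑ ds))) as⊑))))
      , go (b ∷ ds) bs
          (All.map (Span-least ⟨ b ∷ ds ++ bs ⟩ (Span-↭ (shift b ds bs))) as⊑)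
          (ℕ.≤-trans (ℕ.≤-reflexive (≡.sym (↭-length (shift b ds bs)))) len)

  Indep-↭ : ∀ {as bs} → as ↭ bs → Indep as → Indep bs
  Indep-↭ p ind = generating⇒Indep ind (Span-↭ p) (ℕ.≤-reflexive (≡.sym (↭-length p)))

  Indep-++ˡ : ∀ as {bs} → Indep (as ++ bs) → Indep as
  Indep-++ˡ as {bs} ind = Indep-++ʳ bs (Indep-↭ (++-comm as bs) ind)

  Indep-replace : ∀ {as ds} cs → Indep (as ++ cs) → length ds ≡ length as
                → as ⊑ ⟨ ds ++ cs ⟩ → Indep (ds ++ cs)
  Indep-replace {as} {ds} cs ind len as⊑ = generating⇒Indep ind (++⁺ as⊑ (right⊑ ds))
    (ℕ.≤-reflexive (≡.trans (length-++ ds) (≡.trans (≡.cong (ℕ._+ length cs) len) (≡.sym (length-++ as)))))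

  -- A nonzero coefficient at some `b` would allow solving for `b` in terms of the vectors after it,
  -- against independence; so all coefficients along `bs` vanish.
  Indep⇒∩-Span : ∀ bs {as cs v} → Indep (bs ++ as ++ cs)
               → Span (bs ++ as) v → Span (as ++ cs) v → Span as v
  Indep⇒∩-Span []       ind         v∈ _  = v∈
  Indep⇒∩-Span (b ∷ bs) {as} {cs} (b∉ , ind) (cons γ e sp) v∈ with γ ≈? 0#
  ... | yes γ≈0 = Indep⇒∩-Span bs ind (Span-resp (≋-sym (zero-coefficient e γ≈0)) sp) v∈
  ... | no γ≉0  = contradiction
    (member-solve T e γ≉0
      (Span-least T (right⊑ bs) v∈)
      (Span-least T (++⁺ (left⊑ bs) (++⁻ˡ as (right⊑ bs))) sp))
    b∉
    where T = ⟨ bs ++ as ++ cs ⟩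

  -- Bases of subspaces and of intersections.

  record Basis (W : Subspace) (bs : List Vector) : Set where
    constructor basis
    field
      indep    : Indep bs
      contains : bs ⊑ W
      spans    : ∀ {v} → member W v → Span bs v
  open Basis public

  Basis-⟨⟩ : ∀ {bs} → Indep bs → Basis ⟨ bs ⟩ bs
  Basis-⟨⟩ {bs} ind = basis ind (Span-self bs) (λ v∈ → v∈)

  Basis-≐ : ∀ {U W bs} → U ≐ W → Basis U bs → Basis W bs
  Basis-≐ U≐W B = basis (indep B) (All.map (λ {v} → proj₁ (U≐W v)) (contains B))
    (λ {v} v∈ → spans B (proj₂ (U≐W v) v∈))

  Basis-↭ : ∀ {W as bs} → as ↭ bs → Basis W as → Basis W bs
  Basis-↭ {bs = bs} p B = basis (Indep-↭ p (indep B)) (All-resp-↭ p (contains B))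
    (Span-least ⟨ bs ⟩ (Span-↭ p) ∘ spans B)

  Basis-length : ∀ {W as bs} → Basis W as → Basis W bs → length as ≡ length bs
  Basis-length A B = ℕ.≤-antisym
    (Indep⇒length≤ (indep A) (All.map (spans B) (contains A)))
    (Indep⇒length≤ (indep B) (All.map (spans A) (contains B)))

  Basis-extend : ∀ {W as bs} → Indep as → as ⊑ W → Basis W bs
               → ∃ λ cs → length cs ℕ.+ length as ≡ length bs × Basis W (cs ++ as)
  Basis-extend {W} {as} ind as⊑ B with steinitz ind (All.map (spans B) as⊑)
  ... | cs , len , cs⊑ , bs⊑ = cs , len , basis
    (generating⇒Indep (indep B) bs⊑ (ℕ.≤-reflexive (≡.trans (length-++ cs) len)))
    (++⁺ (All.map (Span-least W (contains B)) cs⊑) as⊑)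
    (Span-least ⟨ cs ++ as ⟩ bs⊑ ∘ spans B)

  -- All intersections of the vertices constructed below are computed through this: it is enough to
  -- arrange the two bases as jointly independent blocks with `as` in common.
  Basis-∩ : ∀ {U W as} bs {cs} → Indep (bs ++ as ++ cs)
          → Basis U (bs ++ as) → Basis W (as ++ cs) → Basis (U ∩ W) as
  Basis-∩ {as = as} bs ind B C = basis (Indep-++ˡ as (Indep-++ʳ bs ind))
    (All.zip (++⁻ʳ bs (contains B) , ++⁻ˡ as (contains C)))
    (λ (v∈U , v∈W) → Indep⇒∩-Span bs ind (spans B v∈U) (spans C v∈W))

  -- The projection ⟨ u ∷ us ⟩ ∩ ⟨ ws ⟩ → ⟨ u ⟩ along ⟨ us ⟩ is nonzero exactly when
  -- u lies in ⟨ us ⟩ + ⟨ ws ⟩; its kernel is ⟨ us ⟩ ∩ ⟨ ws ⟩.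
  ∩-basis : ∀ us ws → Indep us → ∃ (Basis (⟨ us ⟩ ∩ ⟨ ws ⟩))
  ∩-basis []       ws _ = [] , basis tt [] proj₁
  ∩-basis (u ∷ us) ws (u∉ , ind) with ∩-basis us ws ind | Span? (us ++ ws) u
  ... | zs , Z | no u∉′ = zs , basis (indep Z)
      (All.map (λ (z∈ , z∈′) → Span-tail z∈ , z∈′) (contains Z)) spans′
    where
    spans′ : ∀ {v} → Span (u ∷ us) v × Span ws v → Span zs v
    spans′ (cons c e sp , v∈) with c ≈? 0#
    ... | yes c≈0 = spans Z (Span-resp (≋-sym (zero-coefficient e c≈0)) sp , v∈)
    ... | no c≉0  = contradiction
      (member-solve ⟨ us ++ ws ⟩ e c≉0 (Span-least ⟨ us ++ ws ⟩ (right⊑ us) v∈)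
        (Span-least ⟨ us ++ ws ⟩ (left⊑ us) sp)) u∉′
  ... | zs , Z | yes u∈ with Span-split us u∈
  -- The new basis vector is `w = u − x`. It is not in the span of `zs`, since that span lies in
  -- `⟨ us ⟩` and `u` would then lie there too.
  ...   | x , w , x∈ , w∈ , u≋x+w = w ∷ zs , basis
      ((λ w∈zs → u∉ (Span-resp (≋-sym u≋x+w)
          (Span-+ x∈ (proj₁ (Span-least (⟨ us ⟩ ∩ ⟨ ws ⟩) (contains Z) w∈zs))))) , indep Z)
      ((member-cancelˡ ⟨ u ∷ us ⟩ u≋x+w Span-head (Span-tail x∈) , w∈)
        ∷ All.map (λ (z∈ , z∈′) → Span-tail z∈ , z∈′) (contains Z))
      spans′
    where
    spans′ : ∀ {v} → Span (u ∷ us) v × Span ws v → Span (w ∷ zs) v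
    -- Rewrite `v = c u + r` as `c w + (c x + r)`: the bracket lies in `⟨ us ⟩` and, being
    -- `v − c w`, also in `⟨ ws ⟩`.
    spans′ {v} (cons c {r} e sp , v∈) = cons c v≋cw+y
      (spans Z (Span-+ (Span-· c x∈) sp , member-cancelˡ ⟨ ws ⟩ v≋cw+y v∈ (Span-· c w∈)))
      where
      v≋cw+y : v ≋ ((c ·V w) +V ((c ·V x) +V r))
      v≋cw+y i = trans (e i) (trans (+-congʳ (*-congˡ (u≋x+w i)))
        (solve 4 (λ c x w r → c :* (x :+ w) :+ r := c :* w :+ (c :* x :+ r)) refl c (x i) (w i) (r i)))

  -- Passage between lists and indexed families.

  Span⇒lincomb : ∀ {bs v} → Span bs v → ∃ λ c → lincomb c (lookup bs) ≋ v
  Span⇒lincomb (nil z) = (λ ()) , ≋-sym z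
  Span⇒lincomb (cons {b} {bs} γ e sp) with Span⇒lincomb sp
  ... | c , f = (λ { F.zero → γ ; (F.suc j) → c j }) ,
    λ i → trans (+-congˡ (f i)) (sym (e i))

  lincomb⇒Span : ∀ {d} c (b : Fin d → Vector) → Span (tabulate b) (lincomb c b)
  lincomb⇒Span {zero}  c b = nil (λ _ → refl)
  lincomb⇒Span {suc d} c b = cons (c F.zero) (λ _ → refl) (lincomb⇒Span (c ∘ F.suc) (b ∘ F.suc))

  Span⇒lincomb-tabulate : ∀ {d} (b : Fin d → Vector) {v} → Span (tabulate b) v
                        → ∃ λ c → lincomb c b ≋ v
  Span⇒lincomb-tabulate {zero}  b (nil z) = (λ ()) , ≋-sym z
  Span⇒lincomb-tabulate {suc d} b (cons γ e sp) with Span⇒lincomb-tabulate (b ∘ F.suc) sp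
  ... | c , f = (λ { F.zero → γ ; (F.suc j) → c j }) ,
    λ i → trans (+-congˡ (f i)) (sym (e i))

  lincomb⇒Span-lookup : ∀ bs c → Span bs (lincomb c (lookup bs))
  lincomb⇒Span-lookup []       c = nil (λ _ → refl)
  lincomb⇒Span-lookup (b ∷ bs) c = cons (c F.zero) (λ _ → refl) (lincomb⇒Span-lookup bs (c ∘ F.suc))

  Indep⇒LinIndep : ∀ bs → Indep bs → LinIndep (lookup bs)
  Indep⇒LinIndep (b ∷ bs) (b∉ , ind) c e with c F.zero ≈? 0#
  ... | no c≉0 = contradiction
    (member-solve ⟨ bs ⟩ (≋-sym e) c≉0 (Span-zero bs) (lincomb⇒Span-lookup bs (c ∘ F.suc))) b∉
  ... | yes c≈0 = λ
    { F.zero    → c≈0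
    ; (F.suc j) → Indep⇒LinIndep bs ind (c ∘ F.suc)
        (≋-sym (zero-coefficient (≋-sym e) c≈0)) j
    }

  LinIndep⇒Indep : ∀ {d} (b : Fin d → Vector) → LinIndep b → Indep (tabulate b)
  LinIndep⇒Indep {zero}  b lin = tt
  LinIndep⇒Indep {suc d} b lin = head∉ , LinIndep⇒Indep (b ∘ F.suc) tail-lin
    where
    tail-lin : LinIndep (b ∘ F.suc)
    tail-lin c e j = lin (λ { F.zero → 0# ; (F.suc j) → c j })
      (λ i → trans (+-cong (zeroˡ (b F.zero i)) (e i)) (+-identityˡ 0#)) (F.suc j)
    head∉ : ¬ Span (tabulate (b ∘ F.suc)) (b F.zero)
    head∉ sp with Span⇒lincomb-tabulate (b ∘ F.suc) sp
    -- The relation with coefficient `- 1#` at the head forces `- 1# ≈ 0#`, whence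
    -- `1# ≈ 1# + - 1# ≈ 0#`.
    ... | c , e = 0≉1 (sym (trans (sym (trans (+-congˡ -1≈0) (+-identityʳ 1#))) (-‿inverseʳ 1#)))
      where
      -1≈0 : - 1# ≈ 0#
      -1≈0 = lin (λ { F.zero → - 1# ; (F.suc j) → c j })
        (λ i → trans (+-cong (-1*x≈-x (b F.zero i)) (e i)) (-‿inverseˡ (b F.zero i))) F.zero

  Basis⇒HasDim : ∀ {W bs d} → length bs ≡ d → Basis W bs → HasDim W d
  Basis⇒HasDim {bs = bs} ≡.refl B = lookup bs , (λ j → All.lookup (contains B) (∈-lookup j)) , Indep⇒LinIndep bs (indep B) ,
    λ v v∈ → Span⇒lincomb (spans B v∈)

  HasDim⇒Basis : ∀ {W d} → HasDim W d → ∃ λ bs → length bs ≡ d × Basis W bs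
  HasDim⇒Basis (b , b∈ , lin , sp) = tabulate b , length-tabulate b , basis
    (LinIndep⇒Indep b lin) (tabulate⁺ b∈)
    (λ v∈ → let c , e = sp _ v∈ in Span-resp e (lincomb⇒Span c b))

  HasDim-unique : ∀ {W d d′} → HasDim W d → HasDim W d′ → d ≡ d′
  HasDim-unique {W} D D′ with HasDim⇒Basis {W} D | HasDim⇒Basis {W} D′
  ... | bs , ≡.refl , B | bs′ , ≡.refl , B′ = Basis-length B B′

  HasDim-≐ : ∀ {U W d} → U ≐ W → HasDim U d → HasDim W d
  HasDim-≐ U≐W (b , b∈ , lin , sp) =
    b , (λ j → proj₁ (U≐W _) (b∈ j)) , lin , λ v v∈ → sp v (proj₂ (U≐W v) v∈)

  -- The whole space and its standard basis.

  sumF-zero : ∀ {d} (f : Fin d → Carrier) → (∀ j → f j ≈ 0#) → sumF f ≈ 0#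
  sumF-zero {zero}  f f≈0 = refl
  sumF-zero {suc d} f f≈0 = trans (+-cong (f≈0 F.zero) (sumF-zero (f ∘ F.suc) (f≈0 ∘ F.suc))) (+-identityˡ 0#)

  δ : ∀ {d} → Fin d → Fin d → Carrier
  δ F.zero    F.zero    = 1#
  δ F.zero    (F.suc j) = 0#
  δ (F.suc i) F.zero    = 0#
  δ (F.suc i) (F.suc j) = δ i j

  sumF-δ : ∀ {d} (c : Fin d → Carrier) i → sumF (λ j → c j ⋆ δ j i) ≈ c i
  sumF-δ c F.zero = trans (+-cong (*-identityʳ (c F.zero)) (sumF-zero _ (λ j → zeroʳ (c (F.suc j)))))
    (+-identityʳ (c F.zero))
  sumF-δ c (F.suc i) = trans (+-cong (zeroʳ (c F.zero)) (sumF-δ (c ∘ F.suc) i)) (+-identityˡ _)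

  wholeSpace : Subspace
  wholeSpace = record
    { member   = λ _ → Unit
    ; resp     = λ _ _ → tt
    ; zero∈    = tt
    ; +-closed = λ _ _ → tt
    ; ·-closed = λ _ _ → tt
    }

  -- This is how `n` enters: a basis of the whole space supplies far pairs of vertices and vectors
  -- outside `U + W`.
  wholeSpace-dim : HasDim wholeSpace n
  wholeSpace-dim = δ , (λ _ → tt) , (λ c e j → trans (sym (sumF-δ c j)) (e j)) , λ v _ → v , sumF-δ v

open import Data.Nat using (_+_; _∸_; _<_)
open import Relation.Binary.PropositionalEquality using (refl; sym; trans; cong; cong₂; subst)

-- Splitting lists, ceilings and block sizes.

splitLength : ∀ {A : Set} m {r} (xs : List A) → length xs ≡ m + r
            → ∃₂ λ ys zs → xs ≡ ys ++ zs × length ys ≡ m × length zs ≡ r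
splitLength zero    xs       len = [] , xs , refl , refl , len
splitLength (suc m) (x ∷ xs) len with splitLength m xs (ℕ.suc-injective len)
... | ys , zs , refl , len₁ , len₂ = x ∷ ys , zs , refl , cong suc len₁ , len₂

pairUp : ∀ {A B : Set} (xs : List A) (ys : List B) → length xs ≡ length ys
       → ∃ λ ps → map proj₁ ps ≡ xs × map proj₂ ps ≡ ys
pairUp []       []       _   = [] , refl , refl
pairUp (x ∷ xs) (y ∷ ys) len with pairUp xs ys (ℕ.suc-injective len)
... | ps , refl , refl = (x , y) ∷ ps , refl , refl

≤ceilDiv* : ∀ a {b} → 1 ≤ b → a ≤ ceilDiv a b * b
≤ceilDiv* a {suc b} _ = ℕ.+-cancelˡ-≤ b _ _ (begin
  b + a                                         ≡⟨ ℕ.+-comm b a ⟩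
  a + b                                         ≡⟨ m≡m%n+[m/n]*n (a + b) (suc b) ⟩
  (a + b) % suc b + (a + b) / suc b * suc b     ≤⟨ ℕ.+-monoˡ-≤ _ (ℕ.m<1+n⇒m≤n (m%n<n (a + b) (suc b))) ⟩
  b + (a + b) / suc b * suc b                   ∎)
  where open ℕ.≤-Reasoning

-- Together with `≤ceilDiv*` this identifies `ceilDiv a b` as the least `m` with `a ≤ m * b`, the
-- form in which both diameter bounds arise.
ceilDiv-least : ∀ a {b m} → 1 ≤ b → a ≤ m * b → ceilDiv a b ≤ m
ceilDiv-least a {suc b} {m} _ a≤ = ℕ.m<1+n⇒m≤n (m<n*o⇒m/o<n {n = suc m} {o = suc b} (s≤s (begin
  a + b              ≡⟨ ℕ.+-comm a b ⟩
  b + a              ≤⟨ ℕ.+-monoʳ-≤ b a≤ ⟩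
  b + m * suc b      ∎)))
  where open ℕ.≤-Reasoning

-- Block sizes for a common neighbour X of U and W as in midpoint, where a = dim (U ∩ W),
-- a + j = dim U = s + e, and both X ∩ U and X ∩ W must get dimension s.
midpointSizes : ∀ {n a j s e} → a + j ≡ s + e → j ≤ 2 * e → 2 * (s + e) ≤ n
  → ∃₂ λ z₁ z₂ → ∃₂ λ p₁ p₂ → ∃₂ λ p₃ t →
    a ≡ z₁ + z₂ × j ≡ p₁ + (p₂ + p₃) × z₁ + p₁ ≡ s × p₁ + (p₂ + t) ≡ e × t + (a + (j + j)) ≤ n
midpointSizes {n} {a} {j} {s} {e} a+j≡ j≤2e 2k≤n with ℕ.≤-total e j
-- Here `p = j − e` and `r = 2e − j`: keep all of `zs`, take both members of `p` pairs and the sums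
-- of `r` pairs, and leave out the last `p` pairs.
... | inj₁ e≤j with ℕ.m≤n⇒∃[o]m+o≡n e≤j
...   | p , refl with ℕ.m≤n⇒∃[o]m+o≡n (ℕ.+-cancelˡ-≤ e p e (subst (e + p ≤_) (cong (e +_) (ℕ.+-identityʳ e)) j≤2e))
...     | r , refl = a , 0 , p , r , p , 0 , sym (ℕ.+-identityʳ a) ,
    solve 2 (λ p r → p :+ r :+ p := p :+ (r :+ p)) refl p r ,
    ℕ.+-cancelʳ-≡ (p + r) _ _ (trans (solve 3 (λ a p r → a :+ p :+ (p :+ r) := a :+ (p :+ r :+ p)) refl a p r) a+j≡) ,
    cong (p +_) (ℕ.+-identityʳ r) , (begin
    a + (j + j)              ≡⟨ ℕ.+-assoc a j j ⟨
    a + j + j                ≤⟨ ℕ.+-monoʳ-≤ (a + j) (ℕ.m≤n+m j a) ⟩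
    a + j + (a + j)          ≡⟨ cong₂ _+_ a+j≡ a+j≡ ⟩
    (s + e) + (s + e)        ≡⟨ cong (s + e +_) (ℕ.+-identityʳ (s + e)) ⟨
    2 * (s + e)              ≤⟨ 2k≤n ⟩
    n ∎)
  where open +-*-Solver
        open ℕ.≤-Reasoning
-- Here `t = e − j`: keep `s` vectors of `zs`, take the sum of every pair, and fill up with `t`
-- vectors from outside.
midpointSizes {n} {a} {j} {s} {e} a+j≡ j≤2e 2k≤n | inj₂ j≤e with ℕ.m≤n⇒∃[o]m+o≡n j≤e
...   | t , refl = s , t , 0 , j , 0 , t ,
    ℕ.+-cancelʳ-≡ j _ _ (trans a+j≡ (solve 3 (λ s j t → s :+ (j :+ t) := s :+ t :+ j) refl s j t)) ,
    sym (ℕ.+-identityʳ j) , ℕ.+-identityʳ s , refl , (begin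
    t + (a + (j + j))        ≡⟨ solve 3 (λ t a j → t :+ (a :+ (j :+ j)) := a :+ j :+ (j :+ t)) refl t a j ⟩
    a + j + (j + t)          ≤⟨ ℕ.+-monoʳ-≤ (a + j) (ℕ.m≤n+m (j + t) s) ⟩
    a + j + (s + (j + t))    ≡⟨ cong (_+ (s + e)) a+j≡ ⟩
    (s + e) + (s + e)        ≡⟨ cong (s + e +_) (ℕ.+-identityʳ (s + e)) ⟨
    2 * (s + e)              ≤⟨ 2k≤n ⟩
    n ∎)
  where open +-*-Solver
        open ℕ.≤-Reasoning

-- Bases adapted to a pair of subspaces.

module AdaptedBases (R : CommutativeRing 0ℓ 0ℓ) {q : ℕ} (isField : IsFiniteField q R) (n : ℕ) where
  open Grassmann R n
  open LinearAlgebra R isField n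
  open CommutativeMonoidSolver (++-commutativeMonoid {A = Vector}) using (solve; _⊕_; _⊜_)

  -- ps lists the pairs (uᵢ , wᵢ) of vectors completing the basis zs of U ∩ W
  -- to bases of U and W.
  record Adapted (U W : Subspace) (zs : List Vector) (ps : List (Vector × Vector)) : Set where
    constructor adapted
    field
      basisˡ : Basis U (zs ++ map proj₁ ps)
      basisʳ : Basis W (zs ++ map proj₂ ps)
      joint  : Indep (zs ++ map proj₁ ps ++ map proj₂ ps)
  open Adapted public

  Basis⇒≐ : ∀ {W bs} → Basis W bs → ⟨ bs ⟩ ≐ W
  Basis⇒≐ {W} B v = Span-least W (contains B) , spans B

  ∩-comm : ∀ {U W} → (U ∩ W) ≐ (W ∩ U)
  ∩-comm v = (λ (a , b) → b , a) , (λ (a , b) → b , a)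

  ∩-≐ : ∀ {U U′ W W′} → U ≐ U′ → W ≐ W′ → (U ∩ W) ≐ (U′ ∩ W′)
  ∩-≐ e f v = (λ (a , b) → proj₁ (e v) a , proj₁ (f v) b) , (λ (a , b) → proj₂ (e v) a , proj₂ (f v) b)

  ∩-idem : ∀ {U W} → U ≐ W → U ≐ (U ∩ W)
  ∩-idem e v = (λ v∈ → v∈ , proj₁ (e v) v∈) , proj₁

  -- If `w = x + y` with `x` in `⟨ ws ⟩` and `y` in `U`, then `y = w − x` also lies in `W`, hence in
  -- `⟨ zs ⟩`; so `w` would depend on `ws ++ zs` alone.
  extensions-Indep : ∀ {U W zs us} ws → Basis (U ∩ W) zs → Basis U (us ++ zs)
                   → ws ⊑ W → Indep (ws ++ zs) → Indep (ws ++ us ++ zs)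
  extensions-Indep []       Z B _ _ = indep B
  extensions-Indep {U} {W} {zs} {us} (w ∷ ws) Z B (w∈ ∷ ws⊑) (w∉ , ind) =
    w∉′ , extensions-Indep ws Z B ws⊑ ind
    where
    w∉′ : ¬ Span (ws ++ us ++ zs) w
    w∉′ w∈′ with Span-split ws w∈′
    ... | x , y , x∈ , y∈ , w≋x+y = w∉ (Span-resp (≋-sym w≋x+y) (Span-+
      (Span-least ⟨ ws ++ zs ⟩ (left⊑ ws) x∈)
      (Span-least ⟨ ws ++ zs ⟩ (right⊑ ws) (spans Z
        ( Span-least U (contains B) y∈
        , member-cancelˡ W w≋x+y w∈ (Span-least W ws⊑ x∈))))))

  -- Equal dimensions make the two completions of `zs` equally long, which is what allows pairing
  -- them.
  adaptedBasis : ∀ {U W k} → HasDim U k → HasDim W k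
               → ∃₂ λ zs ps → length zs + length ps ≡ k × Adapted U W zs ps
  adaptedBasis {U} {W} {k} D E with HasDim⇒Basis {U} D | HasDim⇒Basis {W} E
  ... | as , refl , A | bs , len , B with ∩-basis as bs (indep A)
  ... | zs , Z₀ with Basis-≐ {W = U ∩ W} (∩-≐ {⟨ as ⟩} {U} {⟨ bs ⟩} {W} (Basis⇒≐ A) (Basis⇒≐ B)) Z₀
  ... | Z with Basis-extend {U} (indep Z) (All.map proj₁ (contains Z)) A
             | Basis-extend {W} (indep Z) (All.map proj₂ (contains Z)) B
  ... | us , lenU , BU | ws , lenW , BW
    with pairUp us ws (ℕ.+-cancelʳ-≡ (length zs) _ _ (trans lenU (sym (trans lenW len))))
  ... | ps , refl , refl = zs , ps ,
    trans (cong (length zs +_) (sym (length-map proj₁ ps))) (trans (ℕ.+-comm (length zs) _) lenU) ,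
    adapted (Basis-↭ (++-comm us zs) BU) (Basis-↭ (++-comm ws zs) BW)
      (Indep-↭ (solve 3 (λ ws us zs → (ws ⊕ us ⊕ zs) ⊜ (zs ⊕ us ⊕ ws)) ↭-refl ws us zs)
        (extensions-Indep ws Z BU (++⁻ˡ ws (contains BW)) (indep BW)))

  joint-length : ∀ zs (ps : List (Vector × Vector))
                 → length (zs ++ map proj₁ ps ++ map proj₂ ps) ≡ length zs + (length ps + length ps)
  joint-length zs ps = trans (length-++ zs) (cong (length zs +_) (trans (length-++ (map proj₁ ps))
    (cong₂ _+_ (length-map proj₁ ps) (length-map proj₂ ps))))

  Adapted⇒Basis-∩ : ∀ {U W zs ps} → Adapted U W zs ps → Basis (U ∩ W) zs
  Adapted⇒Basis-∩ {zs = zs} {ps} A = Basis-∩ us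
    (Indep-↭ (solve 3 (λ us zs ws → (zs ⊕ us ⊕ ws) ⊜ (us ⊕ zs ⊕ ws)) ↭-refl us zs ws) (joint A))
    (Basis-↭ (++-comm zs us) (basisˡ A)) (basisʳ A)
    where
    us = map proj₁ ps
    ws = map proj₂ ps

  -- The blocks are cut from a basis of the whole space. Such pairs witness that the diameter is
  -- attained.
  adaptedPair : ∀ a j → a + (j + j) ≤ n
              → ∃₂ λ U W → ∃₂ λ zs ps → length zs ≡ a × length ps ≡ j × Adapted U W zs ps
  adaptedPair a j le with HasDim⇒Basis {wholeSpace} wholeSpace-dim | ℕ.m≤n⇒∃[o]m+o≡n le
  ... | es , len , E | r , eq
    with splitLength a es (trans len (trans (sym eq) (ℕ.+-assoc a (j + j) r)))
  ... | zs , es₁ , refl , refl , len₁ with splitLength j es₁ (trans len₁ (ℕ.+-assoc j j r))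
  ... | us , es₂ , refl , lenU , len₂ with splitLength j es₂ len₂
  ... | ws , es₃ , refl , lenW , _ with pairUp us ws (trans lenU (sym lenW))
  ... | ps , refl , refl = ⟨ zs ++ us ⟩ , ⟨ zs ++ ws ⟩ , zs , ps , refl ,
      trans (sym (length-map proj₁ ps)) lenU , adapted
      (Basis-⟨⟩ (Indep-++ˡ (zs ++ us)
        (Indep-↭ (solve 4 (λ zs us ws es → (zs ⊕ us ⊕ ws ⊕ es) ⊜ ((zs ⊕ us) ⊕ ws ⊕ es)) ↭-refl zs us ws es₃) (indep E))))
      (Basis-⟨⟩ (Indep-++ˡ (zs ++ ws)
        (Indep-↭ (solve 4 (λ zs us ws es → (zs ⊕ us ⊕ ws ⊕ es) ⊜ ((zs ⊕ ws) ⊕ us ⊕ es)) ↭-refl zs us ws es₃) (indep E))))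
      (Indep-++ˡ (zs ++ us ++ ws)
        (Indep-↭ (solve 4 (λ zs us ws es → (zs ⊕ us ⊕ ws ⊕ es) ⊜ ((zs ⊕ us ⊕ ws) ⊕ es)) ↭-refl zs us ws es₃) (indep E)))

  -- Intermediate subspaces.

  sums : List (Vector × Vector) → List Vector
  sums = map (λ (u , w) → u +V w)

  sums-cancelˡ : ∀ T ps → sums ps ⊑ T → map proj₁ ps ⊑ T → map proj₂ ps ⊑ T
  sums-cancelˡ T []             []          []          = []
  sums-cancelˡ T ((u , w) ∷ ps) (d∈ ∷ ds⊑) (u∈ ∷ us⊑) =
    member-cancelˡ T (≋-refl (u +V w)) d∈ u∈ ∷ sums-cancelˡ T ps ds⊑ us⊑

  sums-cancelʳ : ∀ T ps → sums ps ⊑ T → map proj₂ ps ⊑ T → map proj₁ ps ⊑ T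
  sums-cancelʳ T []             []          []          = []
  sums-cancelʳ T ((u , w) ∷ ps) (d∈ ∷ ds⊑) (w∈ ∷ ws⊑) =
    member-cancelʳ T (≋-refl (u +V w)) d∈ w∈ ∷ sums-cancelʳ T ps ds⊑ ws⊑

  -- Since `us₂` stays in the list, `ds` recovers `ws₂`; replacing `ws₂` by equally many vectors
  -- therefore preserves independence. Abstracting `recover` lets the roles of `U` and `W` be
  -- exchanged.
  diagonal-Indep : ∀ zs₁ zs₂ us₁ us₂ us₃ ws₁ {ws₂} ws₃ xs₁ xs₂ ds
    → Indep ((xs₁ ++ xs₂) ++ (zs₁ ++ zs₂) ++ (us₁ ++ us₂ ++ us₃) ++ (ws₁ ++ ws₂ ++ ws₃))
    → length ds ≡ length ws₂ → (∀ T → ds ⊑ T → us₂ ⊑ T → ws₂ ⊑ T)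
    → Indep ((zs₂ ++ us₂ ++ us₃) ++ (zs₁ ++ us₁) ++ (ws₁ ++ ds ++ xs₁))
  diagonal-Indep zs₁ zs₂ us₁ us₂ us₃ ws₁ {ws₂} ws₃ xs₁ xs₂ ds ind len recover =
    Indep-↭ (solve 8 (λ z₁ z₂ u₁ u₂ u₃ w₁ d x₁ →
        (d ⊕ (u₂ ⊕ z₁ ⊕ z₂ ⊕ u₁ ⊕ u₃ ⊕ w₁ ⊕ x₁)) ⊜ ((z₂ ⊕ u₂ ⊕ u₃) ⊕ (z₁ ⊕ u₁) ⊕ (w₁ ⊕ d ⊕ x₁)))
        ↭-refl zs₁ zs₂ us₁ us₂ us₃ ws₁ ds xs₁)
      (Indep-replace {ws₂} {ds} others
        (Indep-++ʳ (xs₂ ++ ws₃) (Indep-↭ (solve 10 (λ z₁ z₂ u₁ u₂ u₃ w₁ w₂ w₃ x₁ x₂ →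
          ((x₁ ⊕ x₂) ⊕ (z₁ ⊕ z₂) ⊕ (u₁ ⊕ u₂ ⊕ u₃) ⊕ (w₁ ⊕ w₂ ⊕ w₃)) ⊜
          ((x₂ ⊕ w₃) ⊕ w₂ ⊕ (u₂ ⊕ z₁ ⊕ z₂ ⊕ u₁ ⊕ u₃ ⊕ w₁ ⊕ x₁)))
          ↭-refl zs₁ zs₂ us₁ us₂ us₃ ws₁ ws₂ ws₃ xs₁ xs₂) ind))
        len (recover ⟨ ds ++ others ⟩ (left⊑ ds) (++⁻ˡ us₂ (right⊑ ds))))
    where others = us₂ ++ zs₁ ++ zs₂ ++ us₁ ++ us₃ ++ ws₁ ++ xs₁

  -- A pair of `ps₁` adds one dimension to each intersection, while `sums ps₂` and `xs₁` enlarge `X`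
  -- without enlarging either.
  midpoint : ∀ {U W} zs₁ zs₂ ps₁ ps₂ ps₃ xs₁ xs₂ → let zs = zs₁ ++ zs₂ ; ps = ps₁ ++ ps₂ ++ ps₃ in
    Adapted U W zs ps → Indep ((xs₁ ++ xs₂) ++ zs ++ map proj₁ ps ++ map proj₂ ps)
    → ∃ λ X → Basis X ((zs₁ ++ map proj₁ ps₁) ++ map proj₂ ps₁ ++ sums ps₂ ++ xs₁)
            × Basis (U ∩ X) (zs₁ ++ map proj₁ ps₁) × Basis (X ∩ W) (zs₁ ++ map proj₂ ps₁)
  midpoint {U} {W} zs₁ zs₂ ps₁ ps₂ ps₃ xs₁ xs₂ (adapted B C _) ind
    rewrite map-++ proj₁ ps₁ (ps₂ ++ ps₃) | map-++ proj₁ ps₂ ps₃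
          | map-++ proj₂ ps₁ (ps₂ ++ ps₃) | map-++ proj₂ ps₂ ps₃ =
    ⟨ (zs₁ ++ us₁) ++ ws₁ ++ ds ++ xs₁ ⟩ , BX ,
    Basis-∩ (zs₂ ++ us₂ ++ us₃) indU (Basis-↭ (blocks zs₁ zs₂ us₁ us₂ us₃) B) BX ,
    Basis-≐ {W ∩ ⟨ (zs₁ ++ us₁) ++ ws₁ ++ ds ++ xs₁ ⟩} (∩-comm {W} {⟨ (zs₁ ++ us₁) ++ ws₁ ++ ds ++ xs₁ ⟩})
      (Basis-∩ (zs₂ ++ ws₂ ++ ws₃) indW (Basis-↭ (blocks zs₁ zs₂ ws₁ ws₂ ws₃) C)
        (Basis-↭ (solve 5 (λ z u w d x → ((z ⊕ u) ⊕ w ⊕ d ⊕ x) ⊜ ((z ⊕ w) ⊕ u ⊕ d ⊕ x))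
          ↭-refl zs₁ us₁ ws₁ ds xs₁) BX))
    where
    us₁ = map proj₁ ps₁
    us₂ = map proj₁ ps₂
    us₃ = map proj₁ ps₃
    ws₁ = map proj₂ ps₁
    ws₂ = map proj₂ ps₂
    ws₃ = map proj₂ ps₃
    ds  = sums ps₂
    blocks : ∀ z₁ z₂ u₁ u₂ u₃ → (z₁ ++ z₂) ++ u₁ ++ u₂ ++ u₃ ↭ (z₂ ++ u₂ ++ u₃) ++ z₁ ++ u₁
    blocks = solve 5 (λ z₁ z₂ u₁ u₂ u₃ →
      ((z₁ ⊕ z₂) ⊕ u₁ ⊕ u₂ ⊕ u₃) ⊜ ((z₂ ⊕ u₂ ⊕ u₃) ⊕ z₁ ⊕ u₁)) ↭-refl
    indU = diagonal-Indep zs₁ zs₂ us₁ us₂ us₃ ws₁ ws₃ xs₁ xs₂ ds ind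
      (trans (length-map _ ps₂) (sym (length-map proj₂ ps₂))) (λ T → sums-cancelˡ T ps₂)
    -- The sums are symmetric in the pair, so the same argument applies with `us` and `ws`
    -- interchanged.
    indW = diagonal-Indep zs₁ zs₂ ws₁ ws₂ ws₃ us₁ us₃ xs₁ xs₂ ds
      (Indep-↭ (solve 4 (λ x z u w → (x ⊕ z ⊕ u ⊕ w) ⊜ (x ⊕ z ⊕ w ⊕ u)) ↭-refl
        (xs₁ ++ xs₂) (zs₁ ++ zs₂) (us₁ ++ us₂ ++ us₃) (ws₁ ++ ws₂ ++ ws₃)) ind)
      (trans (length-map _ ps₂) (sym (length-map proj₁ ps₂))) (λ T → sums-cancelʳ T ps₂)
    BX : Basis ⟨ (zs₁ ++ us₁) ++ ws₁ ++ ds ++ xs₁ ⟩ ((zs₁ ++ us₁) ++ ws₁ ++ ds ++ xs₁)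
    BX = Basis-⟨⟩ (Indep-++ʳ (zs₂ ++ us₂ ++ us₃) indU)

  -- Trading `us₁` for `ws₁` moves these `ws₁` into the common part and leaves `ps₂` as the
  -- remaining pairs, so the argument can be iterated without choosing new bases.
  stepTowards : ∀ {U W} zs ps₁ ps₂ → Adapted U W zs (ps₁ ++ ps₂)
    → ∃ λ X → Basis (U ∩ X) (zs ++ map proj₁ ps₂) × Adapted X W (zs ++ map proj₂ ps₁) ps₂
  stepTowards {U} {W} zs ps₁ ps₂ (adapted B C ind)
    rewrite map-++ proj₁ ps₁ ps₂ | map-++ proj₂ ps₁ ps₂ =
    ⟨ (zs ++ ws₁) ++ us₂ ⟩ ,
    Basis-∩ us₁ (Indep-++ˡ (us₁ ++ (zs ++ us₂) ++ ws₁) (Indep-↭ (solve 5 (λ z u₁ u₂ w₁ w₂ →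
        (z ⊕ (u₁ ⊕ u₂) ⊕ w₁ ⊕ w₂) ⊜ ((u₁ ⊕ (z ⊕ u₂) ⊕ w₁) ⊕ w₂)) ↭-refl zs us₁ us₂ ws₁ ws₂) ind))
      (Basis-↭ (solve 3 (λ z u₁ u₂ → (z ⊕ u₁ ⊕ u₂) ⊜ (u₁ ⊕ z ⊕ u₂)) ↭-refl zs us₁ us₂) B)
      (Basis-↭ (solve 3 (λ z w u → ((z ⊕ w) ⊕ u) ⊜ ((z ⊕ u) ⊕ w)) ↭-refl zs ws₁ us₂) BX) ,
    adapted BX
      (subst (Basis W) (sym (++-assoc zs ws₁ ws₂)) C)
      (Indep-++ʳ us₁ (Indep-↭ (solve 5 (λ z u₁ u₂ w₁ w₂ →
        (z ⊕ (u₁ ⊕ u₂) ⊕ w₁ ⊕ w₂) ⊜ (u₁ ⊕ (z ⊕ w₁) ⊕ u₂ ⊕ w₂)) ↭-refl zs us₁ us₂ ws₁ ws₂) ind))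
    where
    us₁ = map proj₁ ps₁
    us₂ = map proj₁ ps₂
    ws₁ = map proj₂ ps₁
    ws₂ = map proj₂ ps₂
    BX : Basis ⟨ (zs ++ ws₁) ++ us₂ ⟩ ((zs ++ ws₁) ++ us₂)
    BX = Basis-⟨⟩ (Indep-++ʳ (us₁ ++ ws₂) (Indep-↭ (solve 5 (λ z u₁ u₂ w₁ w₂ →
      (z ⊕ (u₁ ⊕ u₂) ⊕ w₁ ⊕ w₂) ⊜ ((u₁ ⊕ w₂) ⊕ (z ⊕ w₁) ⊕ u₂)) ↭-refl zs us₁ us₂ ws₁ ws₂) ind))

  -- Lower bound on the length of a walk.

  -- A complement of `U ∩ X` in `U` has at most `e` vectors, so each edge adds at most `e` to those
  -- already needed for `X`.
  Walk⇒Span : ∀ {k S U W m e ws} → (∀ t → t ∈ S → k ≤ e + toℕ t)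
            → Walk {k} S U W m → Basis (proj₁ W) ws
            → ∃ λ L → length L ≤ m * e × (∀ {v} → member (proj₁ U) v → Span (L ++ ws) v)
  Walk⇒Span {U = U} {W} bound (here U≐W) B = [] , z≤n , λ v∈ → spans B (proj₁ (U≐W _) v∈)
  Walk⇒Span {k} {U = U} {W} {suc m} {e} {ws} bound (step {X = X} (_ , t , t∈ , D) walk) B
    with Walk⇒Span {e = e} bound walk B
  ... | L , len , X⊆ with HasDim⇒Basis {proj₁ U} (proj₂ U) | HasDim⇒Basis {proj₁ U ∩ proj₁ X} D
  ... | us , lenU , BU | zs , lenZ , Z with Basis-extend {proj₁ U} (indep Z) (All.map proj₁ (contains Z)) BU
  ... | cs , lenC , C = cs ++ L ,
      ℕ.≤-trans (ℕ.≤-reflexive (length-++ cs)) (ℕ.+-mono-≤ lenC≤ len) ,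
      λ v∈ → subst (λ M → Span M _) (sym (++-assoc cs L ws))
        (Span-least ⟨ cs ++ L ++ ws ⟩
          (++⁺ (left⊑ cs) (All.map (λ (_ , z∈) → Span-least ⟨ cs ++ L ++ ws ⟩ (right⊑ cs) (X⊆ z∈)) (contains Z)))
          (spans C v∈))
    where
    lenC≤ : length cs ≤ e
    lenC≤ = ℕ.+-cancelʳ-≤ (toℕ t) _ _ (ℕ.≤-trans
      (ℕ.≤-reflexive (trans (cong (length cs +_) (sym lenZ)) (trans lenC lenU))) (bound t t∈))

  -- The list `us ++ zs ++ ws` is independent inside the span of `L ++ zs ++ ws`; cancelling the
  -- common part compares `us` with `L`.
  Walk-length≥ : ∀ {k S U W m e zs ps} → (∀ t → t ∈ S → k ≤ e + toℕ t)
               → Walk {k} S U W m → Adapted (proj₁ U) (proj₁ W) zs ps → length ps ≤ m * e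
  Walk-length≥ {zs = zs} {ps} bound walk A with Walk⇒Span bound walk (basisʳ A)
  ... | L , len , U⊆ = ℕ.≤-trans (ℕ.+-cancelʳ-≤ (length rest) _ _ (begin
    length ps + length rest     ≡⟨ cong (_+ length rest) (length-map proj₁ ps) ⟨
    length us + length rest     ≡⟨ length-++ us ⟨
    length (us ++ rest)         ≤⟨ Indep⇒length≤
        (Indep-↭ (solve 3 (λ us zs ws → (zs ⊕ us ⊕ ws) ⊜ (us ⊕ zs ⊕ ws)) ↭-refl us zs ws) (joint A))
        (++⁺ (All.map U⊆ (++⁻ʳ zs (contains (basisˡ A)))) (right⊑ L)) ⟩
    length (L ++ rest)          ≡⟨ length-++ L ⟩
    length L + length rest      ∎)) len
    where
    open ℕ.≤-Reasoning
    us = map proj₁ ps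
    ws = map proj₂ ps
    rest = zs ++ ws

-- Short walks and the diameter.

module Diameter (R : CommutativeRing 0ℓ 0ℓ) {q : ℕ} (isField : IsFiniteField q R) (n : ℕ)
    {k : ℕ} (2k≤n : 2 * k ≤ n) (S : Subset k) (s : Fin k) (s∈S : s ∈ S) where
  open Grassmann R n
  open LinearAlgebra R isField n
  open AdaptedBases R isField n

  e : ℕ
  e = k ∸ toℕ s

  s+e≡k : toℕ s + e ≡ k
  s+e≡k = ℕ.m+[n∸m]≡n (F.toℕ≤n s)

  1≤e : 1 ≤ e
  1≤e = ℕ.m<n⇒0<n∸m (F.toℕ<n s)

  -- Distinctness is automatic: equal vertices would meet in dimension `k`, whereas `toℕ s < k`.
  Basis⇒Adjacent : ∀ {U W : Vertex k} {zs} → Basis (proj₁ U ∩ proj₁ W) zs → length zs ≡ toℕ s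
                 → Adjacent S U W
  Basis⇒Adjacent {U , D} {W , _} Z len =
    (λ U≐W → ℕ.<-irrefl
      (HasDim-unique {U ∩ W} dim (HasDim-≐ {U} {U ∩ W} (∩-idem {U} {W} U≐W) D)) (F.toℕ<n s)) ,
    s , s∈S , dim
    where
    dim : HasDim (U ∩ W) (toℕ s)
    dim = Basis⇒HasDim len Z

  Basis⇒Vertex : ∀ {U bs} → Basis U bs → length bs ≡ k → Vertex k
  Basis⇒Vertex {U} B len = U , Basis⇒HasDim len B

  -- Equal or adjacent vertices need no separate treatment: they too have a common neighbour, and
  -- length 2 is within every bound considered.
  twoStepWalk : ∀ {U W : Vertex k} {zs ps} → Adapted (proj₁ U) (proj₁ W) zs ps
              → length zs + length ps ≡ k → length ps ≤ 2 * e → Walk S U W 2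
  twoStepWalk {U} {W} {zs} {ps} A lenA ps≤2e
    with HasDim⇒Basis {wholeSpace} wholeSpace-dim
       | midpointSizes {n} {length zs} {length ps} {toℕ s} {e}
           (trans lenA (sym s+e≡k)) ps≤2e (subst (λ k → 2 * k ≤ n) (sym s+e≡k) 2k≤n)
  ... | es , lenE , E | z₁ , z₂ , p₁ , p₂ , p₃ , t , eqz , eqp , eqs , eqe , fits
    -- `xs` completes a basis of `U + W` to one of the whole space; `fits` then says that it has at
    -- least `t` entries.
    with Basis-extend {wholeSpace} (joint A) (All.universal _ _) E
  ... | xs , lenX , F
    with ℕ.m≤n⇒∃[o]m+o≡n (ℕ.+-cancelʳ-≤ (length zs + (length ps + length ps)) t (length xs)
           (ℕ.≤-trans fits (ℕ.≤-reflexive (sym (trans (cong (length xs +_) (sym (joint-length zs ps)))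
             (trans lenX lenE))))))
  ... | _ , eqx
    with splitLength z₁ zs eqz | splitLength p₁ ps eqp | splitLength t xs (sym eqx)
  ... | zs₁ , zs₂ , refl , lz₁ , _ | ps₁ , ps′ , refl , lp₁ , lp′ | xs₁ , xs₂ , refl , lx₁ , _
    with splitLength p₂ ps′ lp′
  ... | ps₂ , ps₃ , refl , lp₂ , _ with midpoint zs₁ zs₂ ps₁ ps₂ ps₃ xs₁ xs₂ A (indep F)
  ... | X , BX , BUX , BXW =
      step {X = V} (Basis⇒Adjacent {U} {V} BUX lenˡ)
        (step {U = V} {X = W} (Basis⇒Adjacent {V} {W} BXW lenʳ) (here (λ v → (λ v∈ → v∈) , (λ v∈ → v∈))))
    where
    lenˡ : length (zs₁ ++ map proj₁ ps₁) ≡ toℕ s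
    lenˡ = trans (length-++ zs₁) (trans (cong₂ _+_ lz₁ (trans (length-map proj₁ ps₁) lp₁)) eqs)
    lenʳ : length (zs₁ ++ map proj₂ ps₁) ≡ toℕ s
    lenʳ = trans (length-++ zs₁) (trans (cong₂ _+_ lz₁ (trans (length-map proj₂ ps₁) lp₁)) eqs)
    lenC : length (map proj₂ ps₁ ++ sums ps₂ ++ xs₁) ≡ e
    lenC = trans (length-++ (map proj₂ ps₁)) (trans (cong₂ _+_ (trans (length-map proj₂ ps₁) lp₁)
      (trans (length-++ (sums ps₂)) (cong₂ _+_ (trans (length-map _ ps₂) lp₂) lx₁))) eqe)
    V : Vertex k
    V = Basis⇒Vertex BX (trans (length-++ (zs₁ ++ map proj₁ ps₁)) (trans (cong₂ _+_ lenˡ lenC) s+e≡k))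

  -- `m` counts the steps available before the final two. While more than `2 * e` pairs remain, one
  -- step removes `e` of them.
  shortWalk : ∀ m {U W : Vertex k} {zs ps} → Adapted (proj₁ U) (proj₁ W) zs ps
            → length zs + length ps ≡ k → length ps ≤ (2 + m) * e
            → ∃ λ l → l ≤ 2 + m × Walk S U W l
  shortWalk m {U} {W} {zs} {ps} A lenA ps≤ with length ps ℕ.≤? 2 * e
  ... | yes ps≤2e = 2 , s≤s (s≤s z≤n) , twoStepWalk {U} {W} A lenA ps≤2e
  shortWalk zero    A lenA ps≤ | no ps≰2e = contradiction ps≤ ps≰2e
  shortWalk (suc m) {U} {W} {zs} {ps} A lenA ps≤ | no ps≰2e
    with ℕ.m≤n⇒∃[o]m+o≡n (ℕ.≤-trans (ℕ.m≤m+n e (e + 0)) (ℕ.<⇒≤ (ℕ.≰⇒> ps≰2e)))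
  ... | r , e+r≡ with splitLength e ps (sym e+r≡)
  ... | ps₁ , ps₂ , refl , lp₁ , refl with stepTowards zs ps₁ ps₂ A
  ... | X , Z , A′ =
      let l , l≤ , walk = shortWalk m {V} {W} A′ lenA′
            -- `(3 + m) * e` unfolds to `e + (2 + m) * e`, so removing `e` pairs costs exactly one
            -- step of the allowance.
            (ℕ.+-cancelˡ-≤ e _ _ (ℕ.≤-trans (ℕ.≤-reflexive e+r≡) ps≤))
      in  suc l , s≤s l≤ , step (Basis⇒Adjacent {U} {V} Z lenZ) walk
    where
    z+e+r≡k : length zs + (e + length ps₂) ≡ k
    z+e+r≡k = trans (cong (length zs +_) e+r≡) lenA
    lenZ : length (zs ++ map proj₁ ps₂) ≡ toℕ s
    lenZ = trans (length-++ zs) (trans (cong (length zs +_) (length-map proj₁ ps₂))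
      (ℕ.+-cancelʳ-≡ e _ _ (trans (solve 3 (λ z r e → z :+ r :+ e := z :+ (e :+ r)) refl (length zs) (length ps₂) e)
        (trans z+e+r≡k (sym s+e≡k)))))
      where open +-*-Solver
    lenA′ : length (zs ++ map proj₂ ps₁) + length ps₂ ≡ k
    lenA′ = trans (cong (_+ length ps₂) (trans (length-++ zs)
        (cong (length zs +_) (trans (length-map proj₂ ps₁) lp₁))))
      (trans (ℕ.+-assoc (length zs) e (length ps₂)) z+e+r≡k)
    V : Vertex k
    V = Basis⇒Vertex (basisˡ A′) (trans (length-++ (zs ++ map proj₂ ps₁))
      (trans (cong (length (zs ++ map proj₂ ps₁) +_) (length-map proj₁ ps₂)) lenA′))

  diameter≤ : ∀ {d} → 2 ≤ d → k ≤ d * e → (U W : Vertex k) → ∃ λ l → l ≤ d × Walk S U W l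
  diameter≤ (s≤s (s≤s {n = m} _)) k≤ U W with adaptedBasis {proj₁ U} {proj₁ W} (proj₂ U) (proj₂ W)
  ... | zs , ps , lenA , A = shortWalk m {U} {W} A lenA (ℕ.≤-trans (ℕ.m≤n+m _ (length zs))
    (ℕ.≤-trans (ℕ.≤-reflexive lenA) k≤))

  -- One far pair suffices: the upper bound supplies a walk of length at most `d` between its
  -- members, and the lower bound makes that length exactly `d`.
  HasDiameter-intro : ∀ {d} → 2 ≤ d → k ≤ d * e
                    → (U W : Vertex k) → (∀ m → Walk S U W m → d ≤ m) → HasDiameter k S d
  HasDiameter-intro 2≤d k≤ U W d≤ with diameter≤ 2≤d k≤ U W
  ... | l , l≤d , walk = diameter≤ 2≤d k≤ , U , W ,
    subst (Walk S U W) (ℕ.≤-antisym l≤d (d≤ l walk)) walk , d≤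

  adaptedVertices : ∀ {a j} → a + j ≡ k
                  → ∃₂ λ (U W : Vertex k) → ∃₂ λ zs ps → length zs ≡ a × length ps ≡ j × Adapted (proj₁ U) (proj₁ W) zs ps
  adaptedVertices {a} {j} a+j≡k with adaptedPair a j (begin
      a + (j + j)      ≡⟨ ℕ.+-assoc a j j ⟨
      a + j + j        ≤⟨ ℕ.+-monoʳ-≤ (a + j) (ℕ.m≤n+m j a) ⟩
      a + j + (a + j)  ≡⟨ cong₂ _+_ a+j≡k a+j≡k ⟩
      k + k            ≡⟨ cong (k +_) (ℕ.+-identityʳ k) ⟨
      2 * k            ≤⟨ 2k≤n ⟩
      n                ∎)
    where open ℕ.≤-Reasoning
  ... | _ , _ , zs , ps , refl , refl , A =
    Basis⇒Vertex (basisˡ A) (trans (length-++ zs) (trans (cong (length zs +_) (length-map proj₁ ps)) a+j≡k)) ,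
    Basis⇒Vertex (basisʳ A) (trans (length-++ zs) (trans (cong (length zs +_) (length-map proj₂ ps)) a+j≡k)) ,
    zs , ps , refl , refl , A

  diameter-s≡0 : toℕ s ≡ 0 → ¬ (S ≡ ⊤) → HasDiameter k S 2
  -- The far pair is made to meet in a dimension `i` outside `S`.
  diameter-s≡0 s≡0 S≢⊤ with F.¬∀⟶∃¬ k (_∈ S) (_∈? S) (λ all∈ → S≢⊤ (⊆-antisym (λ _ → ∈⊤) (λ _ → all∈ _)))
  ... | i , i∉S with adaptedVertices (ℕ.m+[n∸m]≡n (F.toℕ≤n i))
  ... | U , W , zs , ps , lz , lp , A = HasDiameter-intro ℕ.≤-refl k≤2e U W far
    where
    k≤2e : k ≤ 2 * e
    k≤2e = subst (λ t → k ≤ 2 * (k ∸ t)) (sym s≡0) (ℕ.m≤m+n k _)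
    dim : HasDim (proj₁ U ∩ proj₁ W) (toℕ i)
    dim = Basis⇒HasDim lz (Adapted⇒Basis-∩ A)
    far : ∀ m → Walk S U W m → 2 ≤ m
    far 0 (here U≐W) = contradiction (F.toℕ<n i) (ℕ.<-irrefl (HasDim-unique {proj₁ U ∩ proj₁ W} dim
      (HasDim-≐ {proj₁ U} {proj₁ U ∩ proj₁ W} (∩-idem {proj₁ U} {proj₁ W} U≐W) (proj₂ U))))
    -- The walk ends at some `X ≐ W` rather than at `W` itself, so the dimension of `U ∩ X` is
    -- transported before comparing it with `i`.
    far 1 (step {X = X} (_ , t , t∈S , D) (here X≐W)) = contradiction
      (subst (_∈ S) (F.toℕ-injective (HasDim-unique {proj₁ U ∩ proj₁ W}
        (HasDim-≐ {proj₁ U ∩ proj₁ X} {proj₁ U ∩ proj₁ W}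
          (∩-≐ {proj₁ U} {proj₁ U} {proj₁ X} {proj₁ W} (λ v → (λ v∈ → v∈) , (λ v∈ → v∈)) X≐W) D) dim)) t∈S)
      i∉S
    far (suc (suc m)) _ = s≤s (s≤s z≤n)

  diameter-s≢0 : 1 ≤ toℕ s → (∀ t → t ∈ S → s F.≤ t) → HasDiameter k S (ceilDiv k e)
  -- With `a = 0` and `j = k` the two vertices intersect trivially.
  diameter-s≢0 1≤s s-min with adaptedVertices {0} {k} refl
  ... | U , W , zs , ps , _ , lp , A = HasDiameter-intro 2≤ (≤ceilDiv* k 1≤e) U W
      (λ m walk → ceilDiv-least k 1≤e (subst (_≤ m * e) lp (Walk-length≥ {U = U} {W} bound walk A)))
    where
    bound : ∀ t → t ∈ S → k ≤ e + toℕ t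
    bound t t∈ = ℕ.≤-trans (ℕ.≤-reflexive (trans (sym s+e≡k) (ℕ.+-comm (toℕ s) e))) (ℕ.+-monoʳ-≤ e (s-min t t∈))
    e<k : e < k
    e<k = subst (suc e ≤_) s+e≡k (ℕ.+-monoˡ-≤ e 1≤s)
    -- The two-step construction requires `d` to be at least 2; this holds because `s` positive
    -- gives `e < k`.
    2≤ : 2 ≤ ceilDiv k e
    2≤ = ℕ.≰⇒> λ d≤1 → ℕ.<⇒≱ e<k (ℕ.≤-trans (≤ceilDiv* k 1≤e)
      (ℕ.≤-trans (ℕ.*-monoˡ-≤ e d≤1) (ℕ.≤-reflexive (ℕ.*-identityˡ e))))

theorem3p2 : (q : ℕ) → IsPrimePower q
    → (Fq : CommutativeRing 0ℓ 0ℓ) → IsFiniteField q Fq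
    → (n k : ℕ) → 1 ≤ k → 2 * k ≤ n
    → (S : Subset k) → Nonempty S → ¬ (S ≡ ⊤)
    → (s : Fin k) → s ∈ S → (∀ t → t ∈ S → s F.≤ t)
    → Grassmann.HasDiameter Fq n k S (diamValue k (toℕ s))
theorem3p2 q _ Fq isField n k _ 2k≤n S _ S≢⊤ s s∈S s-min = byCases (toℕ s) refl
  where
  open Diameter Fq isField n 2k≤n S s s∈S
  -- `diamValue` matches on its second argument, so `toℕ s` is generalised to `t` with an equation.
  byCases : ∀ t → toℕ s ≡ t → Grassmann.HasDiameter Fq n k S (diamValue k t)
  byCases zero    s≡0 = diameter-s≡0 s≡0 S≢⊤
  byCases (suc t) s≡  = subst (λ u → Grassmann.HasDiameter Fq n k S (ceilDiv k (k ∸ u))) s≡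
    (diameter-s≢0 (subst (1 ≤_) (sym s≡) (s≤s z≤n)) s-min)
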